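{- Let $\mathbb X$ and $\mathbb Y$ be infinite $L$-structures. (I) The following are equivalent: (a) $\mathbb X\preccurlyeq_c\mathbb Y$ holds in some generic (forcing) extension $V[G]$ of the universe; (b) there is a back and forth system $\Pi\subseteq\mathrm{PC}(\mathbb X,\mathbb Y)$; (c) player II has a winning strategy in the game $G^{\preccurlyeq_c}_\omega(\mathbb X,\mathbb Y)$; (d) $\mathbb X\lll_{\mathcal P_{\infty\omega}}\mathbb Y$; (e) $\mathbb Y\lll_{\mathcal N_{\infty\omega}}\mathbb X$. If in addition $\mathbb X$ and $\mathbb Y$ are countable, these are also equivalent to (f) $\mathbb X\preccurlyeq_c\mathbb Y$. (II) The following are equivalent: (a) $\mathbb X\sim_c\mathbb Y$ holds in some generic extension of the universe; (b) there are back and forth systems $\Pi\subseteq\mathrm{PC}(\mathbb X,\mathbb Y)$ and $\Pi'\subseteq\mathrm{PC}(\mathbb Y,\mathbb X)$; (c) player II has winning strategies in both $G^{\preccurlyeq_c}_\omega(\mathbb X,\mathbb Y)$ and $G^{\preccurlyeq_c}_\omega(\mathbb Y,\mathbb X)$; (d) $\mathbb X\equiv_{\mathcal P_{\infty\omega}}\mathbb Y$; (e) $\mathbb X\equiv_{\mathcal N_{\infty\omega}}\mathbb Y$; (f) $\mathbb X\equiv_{\mathcal P_{\infty\omega}\cup\mathcal N_{\infty\omega}}\mathbb Y$; (g) $\mathbb X\lll_{\mathcal P_{\infty\omega}\cup\mathcal N_{\infty\omega}}\mathbb Y$. If in addition $\mathbb X$ and $\mathbb Y$ are countable, these are also equivalent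 to (h) $\mathbb X\sim_c\mathbb Y$.
   Context: $L=\langle R_i:i\in I\rangle$ is a relational language, $R_i$ of arity $n_i$; for an $L$-structure $\mathbb X$ with domain $X$, $R_i^{\mathbb X}$ is the interpretation of $R_i$. For a map $f$ and tuple $\bar x=\langle x_0,\dots,x_{k-1}\rangle$ write $f\bar x=\langle f(x_0),\dots,f(x_{k-1})\rangle$. A partial condensation from $\mathbb X$ to $\mathbb Y$ is a bijection $f$ from a set $\operatorname{dom}f\subseteq X$ onto a set $\operatorname{ran}f\subseteq Y$ such that for all $i\in I$ and $\bar x\in(\operatorname{dom}f)^{n_i}$, $\bar x\in R_i^{\mathbb X}$ implies $f\bar x\in R_i^{\mathbb Y}$; $\mathrm{PC}(\mathbb X,\mathbb Y)$ is the set of these. A condensation is a partial condensation with domain $X$ and range $Y$. $\mathbb X\preccurlyeq_c\mathbb Y$ means there is a condensation from $\mathbb X$ onto $\mathbb Y$; $\mathbb X\sim_c\mathbb Y$ means $\mathbb X\preccurlyeq_c\mathbb Y$ and $\mathbb Y\preccurlyeq_c\mathbb X$. A back and forth system (b.f.s.) is a nonempty $\Pi\subseteq\mathrm{PC}(\mathbb X,\mathbb Y)$ such that (e1) for all $f\in\Pi$ and $x\in X$ there is $g\in\Pi$ with $f\subseteq g$ and $x\in\operatorname{dom}g$, and (e2) for all $f\in\Pi$ and $y\in Y$ there is $g\in\Pi$ with $f\subseteq g$ and $y\in\operatorname{ran}g$. For a cardinal $\kappa$ (finite or infinite), the game $G^{\preccurlyeq_c}_\kappa(\mathbb X,\mathbb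 Y)$ has steps indexed by $\alpha<\kappa$; at step $\alpha$ player I either chooses $x_\alpha\in X$ and then player II chooses $y_\alpha\in Y$, or player I chooses $y_\alpha\in Y$ and then II chooses $x_\alpha\in X$. Player II wins the play iff $\{\langle x_\alpha,y_\alpha\rangle:\alpha<\kappa\}\in\mathrm{PC}(\mathbb X,\mathbb Y)$. A strategy for II determines its move from the previous moves and I's current choice; it is winning if II wins every play in which it is followed. Formula classes: $\mathcal P_0$ consists of all atomic formulas ($v_\alpha=v_\beta$, $R_i(v_{\alpha_1},\dots,v_{\alpha_{n_i}})$) and all $\neg\,v_\alpha=v_\beta$. $\mathcal N_0$ consists of all $\neg R_i(v_{\alpha_1},\dots,v_{\alpha_{n_i}})$, all $v_\alpha=v_\beta$ and all $\neg\,v_\alpha=v_\beta$. $\mathcal P_{\infty\omega}$ (resp. $\mathcal N_{\infty\omega}$) is the closure of $\mathcal P_0$ (resp. $\mathcal N_0$) under $\forall v$, $\exists v$ and conjunctions and disjunctions of arbitrary sets of formulas (no negation). For a class $\mathcal F$ of formulas, $\mathbb X\lll_{\mathcal F}\mathbb Y$ means every sentence of $\mathcal F$ true in $\mathbb X$ is true in $\mathbb Y$, and $\mathbb X\equiv_{\mathcal F}\mathbb Y$ means $\mathbb X$ and $\mathbb Y$ satisfy the same sentences of $\mathcal F$. -}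

module Defs where

open import Data.Fin.Base using (Fin)
open import Data.List.Base using (List; applyUpTo)
open import Data.Nat.Base using (ℕ) renaming (zero to 0ℕ; suc to 1+_)
open import Data.Product.Base using (Σ; Σ-syntax; ∃; _×_; _,_; proj₁; proj₂)
open import Data.Sum.Base using (_⊎_; inj₁; inj₂)
open import Data.Vec.Base as Vec using (Vec; []; _∷_; lookup)
open import Data.Vec.Relation.Binary.Pointwise.Inductive using (Pointwise)
open import Function.Base using (const)
open import Function.Bundles using (_⇔_; _↔_; _↣_)
open import Level using (Level; suc)
open import Relation.Binary.Bundles using (Poset)
open import Relation.Binary.Core using (REL; _⇒_)
open import Relation.Binary.PropositionalEquality.Core using (_≡_)
open import Relation.Nullary.Negation.Core using (¬_)
open import Relation.Unary using (Pred; _∩_; Satisfiable)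

private
  variable
    ℓ a b : Level

Infinite : Set a → Set a
Infinite A = ∀ n → ¬ (A ↔ Fin n)

Countable : Set a → Set a
Countable A = A ↣ ℕ

-- "Sets" are the types in Set ℓ, for a fixed
-- but arbitrary ℓ, and proper classes live in Set (suc ℓ).

record Language (ℓ : Level) : Set (suc ℓ) where
  field
    Symbol : Set ℓ
    arity  : Symbol → ℕ

open Language public

record Structure {ℓ : Level} (L : Language ℓ) : Set (suc ℓ) where
  field
    ∣_∣    : Set ℓ
    ⟦_⟧    : (i : Symbol L) → Pred (Vec ∣_∣ (arity L i)) ℓ

open Structure public

module _ {ℓ : Level} {L : Language ℓ} where

  -- A partial map is given by its graph f.  `Pointwise f xs ys` says that
  -- xs is a tuple in dom f and that ys is the tuple f xs.
  record IsPartialCondensation (𝕏 𝕐 : Structure L)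
                               (f : REL ∣ 𝕏 ∣ ∣ 𝕐 ∣ ℓ) : Set ℓ where
    field
      functional : ∀ {x y y′} → f x y → f x y′ → y ≡ y′
      injective  : ∀ {x x′ y} → f x y → f x′ y → x ≡ x′
      preserves  : ∀ i {xs ys} → Pointwise f xs ys → ⟦ 𝕏 ⟧ i xs → ⟦ 𝕐 ⟧ i ys

  record PC (𝕏 𝕐 : Structure L) : Set (suc ℓ) where
    field
      graph                 : REL ∣ 𝕏 ∣ ∣ 𝕐 ∣ ℓ
      isPartialCondensation : IsPartialCondensation 𝕏 𝕐 graph

  open PC public

  dom : {𝕏 𝕐 : Structure L} → PC 𝕏 𝕐 → Pred ∣ 𝕏 ∣ ℓ
  dom f x = ∃ λ y → graph f x y

  ran : {𝕏 𝕐 : Structure L} → PC 𝕏 𝕐 → Pred ∣ 𝕐 ∣ ℓ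
  ran f y = ∃ λ x → graph f x y

  infix 4 _⊑_ _≼c_ _~c_

  _⊑_ : {𝕏 𝕐 : Structure L} → PC 𝕏 𝕐 → PC 𝕏 𝕐 → Set ℓ
  f ⊑ g = graph f ⇒ graph g

  _≼c_ : Structure L → Structure L → Set (suc ℓ)
  𝕏 ≼c 𝕐 = Σ[ f ∈ PC 𝕏 𝕐 ] (∀ x → dom f x) × (∀ y → ran f y)

  _~c_ : Structure L → Structure L → Set (suc ℓ)
  𝕏 ~c 𝕐 = (𝕏 ≼c 𝕐) × (𝕐 ≼c 𝕏)

  record IsBackAndForthSystem {𝕏 𝕐 : Structure L}
                              (Π : Pred (PC 𝕏 𝕐) ℓ) : Set (suc ℓ) where
    field
      nonempty : Satisfiable Π
      forth    : ∀ {f} → Π f → ∀ x → ∃ λ g → Π g × f ⊑ g × dom g x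
      back     : ∀ {f} → Π f → ∀ y → ∃ λ g → Π g × f ⊑ g × ran g y

  HasBackAndForthSystem : Structure L → Structure L → Set (suc ℓ)
  HasBackAndForthSystem 𝕏 𝕐 =
    Σ[ Π ∈ Pred (PC 𝕏 𝕐) ℓ ] IsBackAndForthSystem {𝕏} {𝕐} Π

  module Game (𝕏 𝕐 : Structure L) where

    MoveI : Set ℓ
    MoveI = ∣ 𝕏 ∣ ⊎ ∣ 𝕐 ∣

    MoveII : MoveI → Set ℓ
    MoveII (inj₁ x) = ∣ 𝕐 ∣
    MoveII (inj₂ y) = ∣ 𝕏 ∣

    Round : Set ℓ
    Round = Σ MoveI MoveII

    pair : Round → ∣ 𝕏 ∣ × ∣ 𝕐 ∣
    pair (inj₁ x , y) = x , y
    pair (inj₂ y , x) = x , y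

    Strategy : Set ℓ
    Strategy = List Round → (m : MoveI) → MoveII m

    Play : Set ℓ
    Play = ℕ → Round

    Follows : Strategy → Play → Set ℓ
    Follows σ π = ∀ n → proj₂ (π n) ≡ σ (applyUpTo π n) (proj₁ (π n))

    WonByII : Play → Set ℓ
    WonByII π = IsPartialCondensation 𝕏 𝕐 λ x y → ∃ λ n → pair (π n) ≡ (x , y)

    IsWinning : Strategy → Set ℓ
    IsWinning σ = ∀ π → Follows σ π → WonByII π

  IIWins : Structure L → Structure L → Set ℓ
  IIWins 𝕏 𝕐 = ∃ λ σ → Game.IsWinning 𝕏 𝕐 σ

-- Well-scoped de Bruijn syntax for L_{∞ω}: a formula in `Formula L n` has its
-- free variables among n given ones.  Every subformula of a sentence has only
-- finitely many free variables, so no sentence is lost.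

data Formula {ℓ : Level} (L : Language ℓ) (n : ℕ) : Set (suc ℓ) where
  _≐_  : Fin n → Fin n → Formula L n
  rel  : (i : Symbol L) → Vec (Fin n) (arity L i) → Formula L n
  neg  : Formula L n → Formula L n
  ⋀ ⋁  : {J : Set ℓ} → (J → Formula L n) → Formula L n
  all  : Formula L (1+ n) → Formula L n
  some : Formula L (1+ n) → Formula L n

infix 8 _≐_

Sentence : {ℓ : Level} → Language ℓ → Set (suc ℓ)
Sentence L = Formula L 0ℕ

module _ {ℓ : Level} {L : Language ℓ} where

  Sat : (𝕏 : Structure L) {n : ℕ} → Vec ∣ 𝕏 ∣ n → Formula L n → Set ℓ
  Sat 𝕏 ρ (u ≐ v)   = lookup ρ u ≡ lookup ρ v
  Sat 𝕏 ρ (rel i v) = ⟦ 𝕏 ⟧ i (Vec.map (lookup ρ) v)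
  Sat 𝕏 ρ (neg φ)   = ¬ Sat 𝕏 ρ φ
  Sat 𝕏 ρ (⋀ φ)     = ∀ j → Sat 𝕏 ρ (φ j)
  Sat 𝕏 ρ (⋁ φ)     = ∃ λ j → Sat 𝕏 ρ (φ j)
  Sat 𝕏 ρ (all φ)   = ∀ x → Sat 𝕏 (x ∷ ρ) φ
  Sat 𝕏 ρ (some φ)  = ∃ λ x → Sat 𝕏 (x ∷ ρ) φ

  infix 4 _⊨_

  _⊨_ : Structure L → Sentence L → Set ℓ
  𝕏 ⊨ φ = Sat 𝕏 [] φ

  data 𝒫₀ {n : ℕ} : Pred (Formula L n) ℓ where
    eq  : ∀ u v → 𝒫₀ (u ≐ v)
    rel : ∀ i v → 𝒫₀ (rel i v)
    neq : ∀ u v → 𝒫₀ (neg (u ≐ v))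

  data 𝒩₀ {n : ℕ} : Pred (Formula L n) ℓ where
    nrel : ∀ i v → 𝒩₀ (neg (rel i v))
    eq   : ∀ u v → 𝒩₀ (u ≐ v)
    neq  : ∀ u v → 𝒩₀ (neg (u ≐ v))

  data Closure (𝓑 : ∀ {n} → Pred (Formula L n) ℓ) {n : ℕ} :
               Pred (Formula L n) (suc ℓ) where
    base : ∀ {φ} → 𝓑 φ → Closure 𝓑 φ
    ⋀    : ∀ {J} {φ : J → Formula L n} →
           (∀ j → Closure 𝓑 (φ j)) → Closure 𝓑 (⋀ φ)
    ⋁    : ∀ {J} {φ : J → Formula L n} →
           (∀ j → Closure 𝓑 (φ j)) → Closure 𝓑 (⋁ φ)
    all  : ∀ {φ} → Closure 𝓑 φ → Closure 𝓑 (all φ)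
    some : ∀ {φ} → Closure 𝓑 φ → Closure 𝓑 (some φ)

  𝒫∞ω : Pred (Sentence L) (suc ℓ)
  𝒫∞ω = Closure 𝒫₀

  𝒩∞ω : Pred (Sentence L) (suc ℓ)
  𝒩∞ω = Closure 𝒩₀

  Preserved : Pred (Sentence L) (suc ℓ) → Structure L → Structure L → Set (suc ℓ)
  Preserved 𝓕 𝕏 𝕐 = ∀ φ → 𝓕 φ → 𝕏 ⊨ φ → 𝕐 ⊨ φ

  Equivalent : Pred (Sentence L) (suc ℓ) → Structure L → Structure L → Set (suc ℓ)
  Equivalent 𝓕 𝕏 𝕐 = ∀ φ → 𝓕 φ → (𝕏 ⊨ φ) ⇔ (𝕐 ⊨ φ)

  syntax Preserved 𝓕 𝕏 𝕐 = 𝕏 ⋘[ 𝓕 ] 𝕐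
  syntax Equivalent 𝓕 𝕏 𝕐 = 𝕏 ≡[ 𝓕 ] 𝕐

-- A statement about V[G] is represented by the set of conditions forcing it;
-- the connectives below are the usual clauses in the recursive definition of
-- the forcing relation.  A smaller condition is stronger.

module Forcing {ℓ : Level} (ℙ : Poset ℓ ℓ ℓ) where

  open Poset ℙ public using (_≤_) renaming (Carrier to Condition)

  DenseBelow : Condition → Pred Condition a → Set _
  DenseBelow p D = ∀ {q} → q ≤ p → ∃ λ r → r ≤ q × D r

  -- Every subset of a ground model set A lying in V[G] is the value of some
  -- name that is a set of pairs ⟨ǎ , s⟩ with a in A and s a condition.
  Name : Set ℓ → Set (suc ℓ)
  Name A = A → Pred Condition ℓ

  infix  8 _∈̇_
  infixr 6 _⇒̇_

  _∈̇_ : {A : Set ℓ} → A → Name A → Pred Condition ℓ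
  (a ∈̇ τ) p = DenseBelow p λ r → ∃ λ s → τ a s × r ≤ s

  -- A statement about the ground model, whose meaning is the same in V[G].
  ⌜_⌝ : Set a → Pred Condition a
  ⌜ A ⌝ = const A

  _⇒̇_ : Pred Condition a → Pred Condition b → Pred Condition _
  (φ ⇒̇ ψ) p = ∀ {q} → q ≤ p → φ q → ψ q

  ∀̇ : {A : Set a} → (A → Pred Condition b) → Pred Condition _
  ∀̇ φ p = ∀ x → φ x p

  ∃̇ : {A : Set a} → (A → Pred Condition b) → Pred Condition _
  ∃̇ φ p = DenseBelow p λ r → ∃ λ x → φ x r

  module _ {L : Language ℓ} where

    -- Tuples are finite, so V[G] has no new tuples of ground model elements.
    IsCondensation : (𝕏 𝕐 : Structure L) → Name (∣ 𝕏 ∣ × ∣ 𝕐 ∣) → Pred Condition ℓ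
    IsCondensation 𝕏 𝕐 f =
      (∀̇ λ x → ∀̇ λ y → ∀̇ λ y′ → (x , y) ∈̇ f ⇒̇ (x , y′) ∈̇ f ⇒̇ ⌜ y ≡ y′ ⌝) ∩
      (∀̇ λ x → ∀̇ λ x′ → ∀̇ λ y → (x , y) ∈̇ f ⇒̇ (x′ , y) ∈̇ f ⇒̇ ⌜ x ≡ x′ ⌝) ∩
      (∀̇ λ i → ∀̇ λ xs → ∀̇ λ ys →
        (∀̇ λ k → (lookup xs k , lookup ys k) ∈̇ f) ⇒̇
        ⌜ ⟦ 𝕏 ⟧ i xs ⌝ ⇒̇ ⌜ ⟦ 𝕐 ⟧ i ys ⌝) ∩
      (∀̇ λ x → ∃̇ λ y → (x , y) ∈̇ f) ∩
      (∀̇ λ y → ∃̇ λ x → (x , y) ∈̇ f)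

    infix 4 _≼̇c_ _~̇c_

    _≼̇c_ : Structure L → Structure L → Pred Condition (suc ℓ)
    𝕏 ≼̇c 𝕐 = ∃̇ λ (f : Name (∣ 𝕏 ∣ × ∣ 𝕐 ∣)) → IsCondensation 𝕏 𝕐 f

    _~̇c_ : Structure L → Structure L → Pred Condition (suc ℓ)
    𝕏 ~̇c 𝕐 = (𝕏 ≼̇c 𝕐) ∩ (𝕐 ≼̇c 𝕏)

-- A statement holds in some generic extension iff some condition of some
-- forcing notion forces it.
InSomeExtension : {ℓ : Level} → ((ℙ : Poset ℓ ℓ ℓ) → Pred (Poset.Carrier ℙ) (suc ℓ)) →
                  Set (suc ℓ)
InSomeExtension φ = ∃ λ ℙ → Satisfiable (φ ℙ)

-- All the conditions are compared with finite back and forth systems: families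
-- of finite partial condensations, containing the empty one, that can be
-- extended to any further point of either structure.  The finite parts of a
-- back and forth system, the initial segments of the plays following a winning
-- strategy and the pairs of tuples x̄, ȳ such that every 𝒫∞ω formula true at x̄
-- is true at ȳ each form such a system.  Conversely, a finite system is itself
-- a forcing notion whose generic filter is a condensation, it tells player II
-- how to answer, and it preserves 𝒫∞ω by induction on formulas.  A name f for a
-- condensation gives the back and forth system of the partial condensations
-- { ⟨x , y⟩ : q ⊩ ⟨x , y⟩ ∈ f }.  Countable structures can be enumerated by
-- player I in a single play, and negation exchanges 𝒫∞ω and 𝒩∞ω.

module Submission where

open import Axiom.ExcludedMiddle using (ExcludedMiddle)
open import Data.Empty using (⊥-elim)
open import Data.Fin.Base using () renaming (zero to 0F; suc to 1F+_)
open import Data.List.Base using (List; []; _∷_; _∷ʳ_; length; foldl; applyUpTo)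
open import Data.List.Membership.Propositional using (_∈_)
open import Data.List.Properties using (applyUpTo-∷ʳ; foldl-∷ʳ)
open import Data.List.Relation.Binary.Subset.Propositional using (_⊆_)
open import Data.List.Relation.Unary.Any using (here; there)
open import Data.Nat.Base using (ℕ; _*_; _<_; _≥_; _≤′_; ≤′-refl; ≤′-step) renaming (zero to 0ℕ; suc to 1+_; _⊔_ to _⊔ℕ_)
open import Data.Nat.Properties as ℕ
  using (_<?_; *-cancelˡ-≡; even≢odd; suc-injective)
open import Data.Product.Base using (∃; ∃₂; _×_; _,_; proj₁; proj₂; map₂)
open import Data.Product.Relation.Binary.Pointwise.NonDependent using (×-poset)
open import Data.Sum.Base using (_⊎_; inj₁; inj₂)
open import Data.Vec.Base as Vec using (Vec; []; _∷_; lookup)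
import Data.Vec.Membership.Propositional.Properties as Vecₚ
import Data.Vec.Relation.Unary.Any as VecAny
import Data.Vec.Relation.Unary.Any.Properties as VecAnyₚ
open import Data.Vec.Properties using (lookup-map)
open import Data.Vec.Relation.Binary.Pointwise.Extensional using (ext; extensional⇒inductive)
open import Data.Vec.Relation.Binary.Pointwise.Inductive as Pointwise using (Pointwise; []; _∷_)
open import Function.Base using (id; _∘_)
open import Function.Bundles using (_⇔_; mk⇔; mk↔ₛ′; Equivalence; Injection)
open import Function.Definitions using (Injective)
open import Level using (Level; suc; Lift; lift; lower; _⊔_)
open import Relation.Binary.Bundles using (Poset)
open import Relation.Binary.Core using (REL; Rel; _⇒_)
open import Relation.Binary.Construct.Interior.Symmetric using (poset)
open import Relation.Binary.Definitions using (Reflexive; Transitive)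
open import Relation.Binary.PropositionalEquality
  using (_≡_; refl; sym; trans; cong; cong₂; subst)
open import Relation.Nullary.Decidable using (Dec; yes; no; True; toWitness; fromWitness; map′; decidable-stable)
open import Relation.Nullary.Negation using (¬_; contradiction)
open import Relation.Unary using (Pred; _∪_)
open import Defs

private
  variable
    ℓ a b i r : Level
    A B : Set a
    L : Language ℓ
    𝕏 𝕐 : Structure L

-- Classical reasoning and enumerations

lowerExcludedMiddle : ExcludedMiddle (suc ℓ) → ExcludedMiddle ℓ
lowerExcludedMiddle {ℓ} em = map′ lower lift (em {Lift (suc ℓ) _})

module Resizing (em : ExcludedMiddle (suc ℓ)) where

  -- Excluded middle one level up decides `P`, and the truth value of the decision is a copy of `P`
  -- in `Set ℓ`. It brings down conditions that quantify over `PC` or over formulas.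
  Resized : Set (suc ℓ) → Set ℓ
  Resized P = Lift ℓ (True (em {P}))

  resize : {P : Set (suc ℓ)} → P → Resized P
  resize = lift ∘ fromWitness

  unresize : {P : Set (suc ℓ)} → Resized P → P
  unresize = toWitness ∘ lower

inhabited : ExcludedMiddle ℓ → {A : Set ℓ} → Infinite A → A
inhabited em {A} infinite = decidable-stable em λ empty →
  infinite 0 (mk↔ₛ′ (⊥-elim ∘ empty) (λ ()) (λ ()) (⊥-elim ∘ empty))

enumeration : ExcludedMiddle ℓ → {A : Set ℓ} → A → {f : A → ℕ} → Injective _≡_ _≡_ f →
              ∃ λ (e : ℕ → A) → ∀ x → ∃ λ n → e n ≡ x
enumeration em {A} default {f} injective = e , λ x → f x , e-f x
  where
  invert : ∀ n → Dec (∃ λ x → f x ≡ n) → A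
  invert n (yes (x , _)) = x
  invert n (no _)        = default

  e : ℕ → A
  e n = invert n em

  e-f : ∀ x → e (f x) ≡ x
  e-f x with em {∃ λ x′ → f x′ ≡ f x}
  ... | yes (x′ , fx′≡fx) = injective fx′≡fx
  ... | no  ∄x            = contradiction (x , refl) ∄x

module _ (f : A → ℕ) (g : B → ℕ) where

  -- Parity keeps the two structures apart, so that a single sequence can run through all moves of
  -- player I.
  interleave : A ⊎ B → ℕ
  interleave (inj₁ x) = 2 * f x
  interleave (inj₂ y) = 1+ (2 * g y)

  interleave-injective : Injective _≡_ _≡_ f → Injective _≡_ _≡_ g →
                         Injective _≡_ _≡_ interleave
  interleave-injective f-inj g-inj {inj₁ x} {inj₁ x′} p =
    cong inj₁ (f-inj (*-cancelˡ-≡ (f x) (f x′) 2 p))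
  interleave-injective f-inj g-inj {inj₁ x} {inj₂ y} p =
    contradiction p (even≢odd (f x) (g y))
  interleave-injective f-inj g-inj {inj₂ y} {inj₁ x} p =
    contradiction (sym p) (even≢odd (f x) (g y))
  interleave-injective f-inj g-inj {inj₂ y} {inj₂ y′} p =
    cong inj₂ (g-inj (*-cancelˡ-≡ (g y) (g y′) 2 (suc-injective p)))

-- Partial condensations

open IsPartialCondensation

Graph : List (A × B) → REL A B _
Graph l x y = (x , y) ∈ l

restrict : {𝕏 𝕐 : Structure L} {f g : REL ∣ 𝕏 ∣ ∣ 𝕐 ∣ _} → f ⇒ g →
           IsPartialCondensation 𝕏 𝕐 g → IsPartialCondensation 𝕏 𝕐 f
restrict f⊆g pc = record
  { functional = λ fxy fxy′ → functional pc (f⊆g fxy) (f⊆g fxy′)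
  ; injective  = λ fxy fx′y → injective pc (f⊆g fxy) (f⊆g fx′y)
  ; preserves  = λ i → preserves pc i ∘ Pointwise.map f⊆g
  }

module _ {L : Language ℓ} {𝕏 𝕐 : Structure L}
         {I : Set i} {_≼_ : Rel I r} (≼-refl : Reflexive _≼_) (≼-trans : Transitive _≼_)
         {R : I → REL ∣ 𝕏 ∣ ∣ 𝕐 ∣ ℓ} (R-mono : ∀ {p q} → p ≼ q → R q ⇒ R p)
         (pc : ∀ p → IsPartialCondensation 𝕏 𝕐 (R p)) where

  DenselyBelow : I → REL ∣ 𝕏 ∣ ∣ 𝕐 ∣ _
  DenselyBelow p x y = ∀ {q} → q ≼ p → ∃ λ s → s ≼ q × R s x y

  -- Each clause concerns finitely many pairs, and these can be collected one after another into a
  -- single `R s`, where `pc s` applies. It serves the generic relation as well as an infinite play.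
  limitIsPartialCondensation :
    ∀ p {f : REL ∣ 𝕏 ∣ ∣ 𝕐 ∣ ℓ} → f ⇒ DenselyBelow p → IsPartialCondensation 𝕏 𝕐 f
  limitIsPartialCondensation p {f} dense = record
    { functional = λ fxy fxy′ →
        let q , q≼p , Rxy  = dense fxy ≼-refl
            s , s≼q , Rxy′ = dense fxy′ q≼p
        in functional (pc s) (R-mono s≼q Rxy) Rxy′
    ; injective = λ fxy fx′y →
        let q , q≼p , Rxy  = dense fxy ≼-refl
            s , s≼q , Rx′y = dense fx′y q≼p
        in injective (pc s) (R-mono s≼q Rxy) Rx′y
    ; preserves = λ i fs → let s , _ , Rs = common fs in preserves (pc s) i Rs
    }
    where
    common : ∀ {n} {xs : Vec ∣ 𝕏 ∣ n} {ys : Vec ∣ 𝕐 ∣ n} → Pointwise f xs ys → ∃ λ s → s ≼ p × Pointwise (R s) xs ys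
    common []         = p , ≼-refl , []
    common (fxy ∷ fs) =
      let q , q≼p , Rs  = common fs
          s , s≼q , Rxy = dense fxy q≼p
      in s , ≼-trans s≼q q≼p , Rxy ∷ Pointwise.map (R-mono s≼q) Rs

-- Lists rather than `PC`: the good ones have to be the conditions of a poset in `Set ℓ`, and
-- `PC 𝕏 𝕐` lives in `Set (suc ℓ)`.
record FiniteSystem {L : Language ℓ} (𝕏 𝕐 : Structure L) : Set (suc ℓ) where
  field
    Good     : Pred (List (∣ 𝕏 ∣ × ∣ 𝕐 ∣)) ℓ
    sound    : ∀ {l} → Good l → IsPartialCondensation 𝕏 𝕐 (Graph l)
    nonempty : Good []
    forth    : ∀ {l} → Good l → ∀ x → ∃ λ y → Good ((x , y) ∷ l)
    back     : ∀ {l} → Good l → ∀ y → ∃ λ x → Good ((x , y) ∷ l)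

-- Generic extensions

module _ (ℙ : Poset ℓ ℓ ℓ) {L : Language ℓ} {𝕏 𝕐 : Structure L} where
  open Forcing ℙ
  open Poset ℙ using () renaming (refl to ≤-refl; trans to ≤-trans)

  ∈̇-mono : {A : Set ℓ} {x : A} (τ : Name A) {p q : Condition} →
            q ≤ p → (x ∈̇ τ) p → (x ∈̇ τ) q
  ∈̇-mono τ q≤p x∈̇τ r≤q = x∈̇τ (≤-trans r≤q q≤p)

  module _ (f : Name (∣ 𝕏 ∣ × ∣ 𝕐 ∣)) where

    forcedGraph : Condition → REL ∣ 𝕏 ∣ ∣ 𝕐 ∣ ℓ
    forcedGraph q x y = ((x , y) ∈̇ f) q

    forcedIsPartialCondensation : ∀ {p} → IsCondensation 𝕏 𝕐 f p → ∀ {q} → q ≤ p →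
                                  IsPartialCondensation 𝕏 𝕐 (forcedGraph q)
    forcedIsPartialCondensation (fun , inj , pres , _ , _) q≤p = record
      { functional = λ xy∈f xy′∈f → fun _ _ _ q≤p xy∈f ≤-refl xy′∈f
      ; injective  = λ xy∈f x′y∈f → inj _ _ _ q≤p xy∈f ≤-refl x′y∈f
      ; preserves  = λ i xys∈f → pres i _ _ q≤p (Pointwise.lookup xys∈f) ≤-refl
      }

    forcedIsCondensation : ∀ {p} →
      (∀ q → IsPartialCondensation 𝕏 𝕐 (forcedGraph q)) →
      (∀ x q → ∃ λ r → r ≤ q × ∃ λ y → forcedGraph r x y) →
      (∀ y q → ∃ λ r → r ≤ q × ∃ λ x → forcedGraph r x y) →
      IsCondensation 𝕏 𝕐 f p
    forcedIsCondensation pc total onto =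
      (λ _ _ _ _ xy∈f r≤q xy′∈f → functional (pc _) (∈̇-mono f r≤q xy∈f) xy′∈f) ,
      (λ _ _ _ _ xy∈f r≤q x′y∈f → injective (pc _) (∈̇-mono f r≤q xy∈f) x′y∈f) ,
      (λ i _ _ _ xys∈f _ → preserves (pc _) i (extensional⇒inductive (ext xys∈f))) ,
      (λ x _ → total x _) ,
      (λ y _ → onto y _)

    forcedSystem : ∀ {p} → IsCondensation 𝕏 𝕐 f p → HasBackAndForthSystem 𝕏 𝕐
    forcedSystem {p} p⊩f@(_ , _ , _ , total , onto) = Π , record
      { nonempty = forced ≤-refl , p , ≤-refl , id
      ; forth = λ {(q , q≤p , g⊆f) x →
          let r , r≤q , y , xy∈f = total x q≤p
              r≤p = ≤-trans r≤q q≤p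
          in forced r≤p , (r , r≤p , id) , ∈̇-mono f r≤q ∘ g⊆f , y , xy∈f }
      ; back = λ {(q , q≤p , g⊆f) y →
          let r , r≤q , x , xy∈f = onto y q≤p
              r≤p = ≤-trans r≤q q≤p
          in forced r≤p , (r , r≤p , id) , ∈̇-mono f r≤q ∘ g⊆f , x , xy∈f }
      }
      where
      forced : ∀ {q} → q ≤ p → PC 𝕏 𝕐
      forced {q} q≤p = record
        { graph                 = forcedGraph q
        ; isPartialCondensation = forcedIsPartialCondensation p⊩f q≤p
        }

      -- Inclusion takes the place of equality with some `forced`, since equality of elements of
      -- `PC 𝕏 𝕐` has level `suc ℓ`.
      Π : Pred (PC 𝕏 𝕐) ℓ
      Π g = ∃ λ q → q ≤ p × (graph g ⇒ forcedGraph q)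

  forces⇒system : ∀ {p} → (𝕏 ≼̇c 𝕐) p → HasBackAndForthSystem 𝕏 𝕐
  forces⇒system p⊩ = let _ , _ , f , r⊩f = p⊩ ≤-refl in forcedSystem f r⊩f

  module _ (S : FiniteSystem 𝕏 𝕐) (part : Condition → ∃ (FiniteSystem.Good S))
           (part-mono : ∀ {p q} → p ≤ q → proj₁ (part q) ⊆ proj₁ (part p))
           (total : ∀ x q → ∃ λ r → r ≤ q × ∃ λ y → (x , y) ∈ proj₁ (part r))
           (onto  : ∀ y q → ∃ λ r → r ≤ q × ∃ λ x → (x , y) ∈ proj₁ (part r)) where

    -- A name for the union of the lists attached to the members of the generic filter.
    generic : Name (∣ 𝕏 ∣ × ∣ 𝕐 ∣)
    generic xy p = xy ∈ proj₁ (part p)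

    generic⁺ : ∀ {p} → Graph (proj₁ (part p)) ⇒ forcedGraph generic p
    generic⁺ {p} xy∈p {q} q≤p = q , ≤-refl , p , xy∈p , q≤p

    generic⁻ : ∀ {p} → forcedGraph generic p ⇒
               λ x y → ∀ {q} → q ≤ p → ∃ λ r → r ≤ q × (x , y) ∈ proj₁ (part r)
    generic⁻ xy∈f q≤p =
      let r , r≤q , s , xy∈s , r≤s = xy∈f q≤p in r , r≤q , part-mono r≤s xy∈s

    -- A pair forced into `generic` belongs to the lists of densely many conditions, so the limit
    -- lemma applies; `total` and `onto` are density arguments. `ℙ` is left abstract so that one
    -- forcing notion can project to two finite systems.
    forcesCondensation : ∀ p → (𝕏 ≼̇c 𝕐) p
    forcesCondensation p {q} _ = q , ≤-refl , generic , forcedIsCondensation generic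
      (λ q → limitIsPartialCondensation ≤-refl ≤-trans
               {R = Graph ∘ proj₁ ∘ part} (λ r≤q → part-mono r≤q)
               (FiniteSystem.sound S ∘ proj₂ ∘ part) q generic⁻)
      (λ x q → let r , r≤q , y , xy∈r = total x q in r , r≤q , y , generic⁺ xy∈r)
      (λ y q → let r , r≤q , x , xy∈r = onto y q in r , r≤q , x , generic⁺ xy∈r)

-- Different lists can have the same pairs, so inclusion is only a preorder; taking its symmetric
-- interior as the equality makes it a partial order.
conditions : {L : Language ℓ} {𝕏 𝕐 : Structure L} → FiniteSystem 𝕏 𝕐 → Poset ℓ ℓ ℓ
conditions S = poset {A = ∃ (FiniteSystem.Good S)} {R = λ p q → proj₁ q ⊆ proj₁ p}
  id (λ q⊆p r⊆q → q⊆p ∘ r⊆q)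

-- The stronger condition q is passed explicitly below: the order compares only
-- the lists, so q cannot be inferred from it.
system⇒extension : FiniteSystem 𝕏 𝕐 → InSomeExtension (λ ℙ → Forcing._≼̇c_ ℙ 𝕏 𝕐)
system⇒extension S = conditions S , start , λ {q} →
  forcesCondensation (conditions S) S id id
    (λ x (l , g) → let y , g′ = forth g x in (_ , g′) , there , y , here refl)
    (λ y (l , g) → let x , g′ = back g y in (_ , g′) , there , x , here refl)
    start {q}
  where
  open FiniteSystem S

  start = [] , nonempty

-- Both condensations must exist in one and the same extension. The product forcing adds them
-- together, each factor being extended while the other stays fixed.
systems⇒extension : FiniteSystem 𝕏 𝕐 → FiniteSystem 𝕐 𝕏 →
                    InSomeExtension (λ ℙ → Forcing._~̇c_ ℙ 𝕏 𝕐)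
systems⇒extension S T = ℙ , start ,
  (λ {q} → forcesCondensation ℙ S proj₁ proj₁
    (λ x ((l , g) , p) → let y , g′ = S.forth g x in ((_ , g′) , p) , (there , id) , y , here refl)
    (λ y ((l , g) , p) → let x , g′ = S.back g y in ((_ , g′) , p) , (there , id) , x , here refl)
    start {q}) ,
  (λ {q} → forcesCondensation ℙ T proj₂ proj₂
    (λ y (p , (l , g)) → let x , g′ = T.forth g y in (p , (_ , g′)) , (id , there) , x , here refl)
    (λ x (p , (l , g)) → let y , g′ = T.back g x in (p , (_ , g′)) , (id , there) , y , here refl)
    start {q})
  where
  module S = FiniteSystem S
  module T = FiniteSystem T

  ℙ     = ×-poset (conditions S) (conditions T)
  start = ([] , S.nonempty) , ([] , T.nonempty)

module _ (em : ExcludedMiddle (suc ℓ)) {L : Language ℓ} {𝕏 𝕐 : Structure L} where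
  open Resizing em

  backAndForth⇒finite : HasBackAndForthSystem 𝕏 𝕐 → FiniteSystem 𝕏 𝕐
  backAndForth⇒finite (Π , bf) = record
    { Good     = λ l → Resized (Good l)
    ; sound    = λ g → let f , _ , l⊆f = unresize g in restrict l⊆f (isPartialCondensation f)
    ; nonempty = resize (let f , Πf = nonempty in f , Πf , λ ())
    ; forth    = λ g x →
        let f , Πf , l⊆f             = unresize g
            f′ , Πf′ , f⊆f′ , y , xy = forth Πf x
        in y , resize (f′ , Πf′ , λ { (here refl) → xy ; (there ∈l) → f⊆f′ (l⊆f ∈l) })
    ; back     = λ g y →
        let f , Πf , l⊆f             = unresize g
            f′ , Πf′ , f⊆f′ , x , xy = back Πf y
        in x , resize (f′ , Πf′ , λ { (here refl) → xy ; (there ∈l) → f⊆f′ (l⊆f ∈l) })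
    }
    where
    open IsBackAndForthSystem bf

    Good : Pred (List (∣ 𝕏 ∣ × ∣ 𝕐 ∣)) (suc ℓ)
    Good l = ∃ λ f → Π f × (Graph l ⇒ graph f)

-- The system is in effect the singleton of `f`: since `f` is total, a partial condensation
-- containing it has the same graph.
condensation⇒backAndForth : 𝕏 ≼c 𝕐 → HasBackAndForthSystem 𝕏 𝕐
condensation⇒backAndForth (f , total , onto) = (f ⊑_) , record
  { nonempty = f , id
  ; forth    = λ {g} f⊑g x → let y , xy = total x in g , f⊑g , id , y , f⊑g xy
  ; back     = λ {g} f⊑g y → let x , xy = onto y in g , f⊑g , id , x , f⊑g xy
  }

-- Games

module _ {L : Language ℓ} {𝕏 𝕐 : Structure L} where
  open Game 𝕏 𝕐

  pair-inj₁ : ∀ r {x} → proj₁ r ≡ inj₁ x → ∃ λ y → pair r ≡ (x , y)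
  pair-inj₁ (inj₁ x , y) refl = y , refl

  pair-inj₂ : ∀ r {y} → proj₁ r ≡ inj₂ y → ∃ λ x → pair r ≡ (x , y)
  pair-inj₂ (inj₂ y , x) refl = x , refl

  module _ (σ : Strategy) where

    -- Player I's moves `μ` are fixed in advance. Building the history together with the play makes
    -- the recursion structural; `applyUpTo-play` then recovers the form that `Follows` asks for.
    history : (ℕ → MoveI) → ℕ → List Round
    play    : (ℕ → MoveI) → Play

    history μ 0ℕ     = []
    history μ (1+ n) = history μ n ∷ʳ play μ n

    play μ n = μ n , σ (history μ n) (μ n)

    applyUpTo-play : ∀ μ n → applyUpTo (play μ) n ≡ history μ n
    applyUpTo-play μ 0ℕ     = refl
    applyUpTo-play μ (1+ n) =
      trans (sym (applyUpTo-∷ʳ (play μ) n)) (cong (_∷ʳ play μ n) (applyUpTo-play μ n))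

    play-follows : ∀ μ → Follows σ (play μ)
    play-follows μ n = sym (cong (λ h → σ h (μ n)) (applyUpTo-play μ n))

    module _ {μ ν : ℕ → MoveI} where

      -- A strategy sees the past and the current choice only, hence the bound `n` for the history
      -- and `1+ n` for the round.
      history-cong : ∀ n → (∀ {k} → k < n → μ k ≡ ν k) → history μ n ≡ history ν n
      play-cong    : ∀ n → (∀ {k} → k < 1+ n → μ k ≡ ν k) → play μ n ≡ play ν n

      history-cong 0ℕ     μ≗ν = refl
      history-cong (1+ n) μ≗ν =
        cong₂ _∷ʳ_ (history-cong n (μ≗ν ∘ ℕ.m≤n⇒m≤1+n)) (play-cong n μ≗ν)

      play-cong n μ≗ν =
        cong₂ (λ h m → m , σ h m) (history-cong n (μ≗ν ∘ ℕ.m≤n⇒m≤1+n)) (μ≗ν ℕ.≤-refl)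

    change : ∀ (μ : ℕ → MoveI) n m → ∃ λ (ν : ℕ → MoveI) → ν n ≡ m × (∀ {k} → k < n → ν k ≡ μ k)
    change μ n m = ν , ν-n , ν-<
      where
      ν : ℕ → MoveI
      ν k with k <? n
      ... | yes _ = μ k
      ... | no  _ = m

      ν-n : ν n ≡ m
      ν-n with n <? n
      ... | yes n<n = contradiction n<n (ℕ.<-irrefl refl)
      ... | no  _   = refl

      ν-< : ∀ {k} → k < n → ν k ≡ μ k
      ν-< {k} k<n with k <? n
      ... | yes _   = refl
      ... | no  k≮n = contradiction k<n k≮n

    -- Only finitely many rounds count, but a full sequence of moves is kept because `IsWinning`
    -- speaks of infinite plays.
    Reachable : Pred (List (∣ 𝕏 ∣ × ∣ 𝕐 ∣)) ℓ
    Reachable l = ∃₂ λ μ n → ∀ {xy} → xy ∈ l → ∃ λ k → k < n × pair (play μ k) ≡ xy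

    -- Player I deviates at move `n`. The rounds before it, which contain `l`, are unaffected, and
    -- round `n` supplies the new pair.
    extend : ∀ {l} → Reachable l → ∀ m → ∃ λ r → proj₁ r ≡ m × Reachable (pair r ∷ l)
    extend (μ , n , l⊆μ) m =
      let ν , νn≡m , ν≗μ = change μ n m
      in play ν n , νn≡m , ν , 1+ n , λ
        { (here refl) → n , ℕ.≤-refl , refl
        ; (there ∈l)  → let k , k<n , k≡ = l⊆μ ∈l in
            k , ℕ.m≤n⇒m≤1+n k<n ,
            trans (cong pair (play-cong k λ j≤k → ν≗μ (ℕ.≤-trans j≤k k<n))) k≡
        }

    winning⇒finite : MoveI → IsWinning σ → FiniteSystem 𝕏 𝕐
    winning⇒finite default winning = record
      { Good     = Reachable
      ; sound    = λ (μ , n , l⊆μ) →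
          restrict (λ xy∈l → let k , _ , k≡ = l⊆μ xy∈l in k , k≡)
                   (winning (play μ) (play-follows μ))
      -- Even the empty list has to come from a play, so player I needs some move to repeat.
      ; nonempty = (λ _ → default) , 0 , λ ()
      ; forth    = λ g x → forth (extend g (inj₁ x))
      ; back     = λ g y → back (extend g (inj₂ y))
      }
      where
      forth : ∀ {l x} → (∃ λ r → proj₁ r ≡ inj₁ x × Reachable (pair r ∷ l)) →
              ∃ λ y → Reachable ((x , y) ∷ l)
      forth ((inj₁ x , y) , refl , g) = y , g

      back : ∀ {l y} → (∃ λ r → proj₁ r ≡ inj₂ y × Reachable (pair r ∷ l)) →
             ∃ λ x → Reachable ((x , y) ∷ l)
      back ((inj₂ y , x) , refl , g) = x , g

    winning⇒condensation : (∃ λ μ → ∀ m → ∃ λ n → μ n ≡ m) → IsWinning σ → 𝕏 ≼c 𝕐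
    winning⇒condensation (μ , onto) winning =
      record { isPartialCondensation = winning (play μ) (play-follows μ) } ,
      (λ x → let n , μn≡x = onto (inj₁ x)
                 y , k≡   = pair-inj₁ (play μ n) μn≡x
             in y , n , k≡) ,
      (λ y → let n , μn≡y = onto (inj₂ y)
                 x , k≡   = pair-inj₂ (play μ n) μn≡y
             in x , n , k≡)

  -- Histories grow at the end and good lists at the front; the left fold turns a further round into
  -- a cons.
  trace : List Round → List (∣ 𝕏 ∣ × ∣ 𝕐 ∣)
  trace = foldl (λ l r → pair r ∷ l) []

  position : Play → ℕ → List (∣ 𝕏 ∣ × ∣ 𝕐 ∣)
  position π n = trace (applyUpTo π n)

  position-suc : ∀ π n → position π (1+ n) ≡ pair (π n) ∷ position π n
  position-suc π n = trans (cong trace (sym (applyUpTo-∷ʳ π n)))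
                           (foldl-∷ʳ _ [] (π n) (applyUpTo π n))

  position-mono : ∀ π {m n} → m ≤′ n → position π m ⊆ position π n
  position-mono π ≤′-refl               = id
  position-mono π (≤′-step {n = n} m≤n) =
    subst (_ ∈_) (sym (position-suc π n)) ∘ there ∘ position-mono π m≤n

  module _ (em : ExcludedMiddle ℓ) (S : FiniteSystem 𝕏 𝕐) where
    open FiniteSystem S

    respond : ∀ {l} → Good l → ∀ m → MoveII m
    respond g (inj₁ x) = proj₁ (forth g x)
    respond g (inj₂ y) = proj₁ (back g y)

    respond-good : ∀ {l} (g : Good l) m → Good (pair (m , respond g m) ∷ l)
    respond-good g (inj₁ x) = proj₂ (forth g x)
    respond-good g (inj₂ y) = proj₂ (back g y)

    answer : ∀ {l} → Dec (Good l) → ∀ m → MoveII m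
    answer (yes g) = respond g
    -- Not reached in plays that follow the strategy, but every history needs an answer; the one for
    -- the empty position will do.
    answer (no _)  = respond nonempty

    answer-good : ∀ {l} (g? : Dec (Good l)) → Good l → ∀ m →
                  Good (pair (m , answer g? m) ∷ l)
    answer-good (yes g) _ = respond-good g
    answer-good (no ¬g) g = contradiction g ¬g

    strategy : Strategy
    strategy h = answer {trace h} em

    position-good : ∀ π → Follows strategy π → ∀ n → Good (position π n)
    position-good π follows 0ℕ     = nonempty
    position-good π follows (1+ n) = subst Good (sym (position-suc π n))
      (subst (λ r → Good (pair (proj₁ (π n) , r) ∷ position π n)) (sym (follows n))
        (answer-good em (position-good π follows n) (proj₁ (π n))))

    finite⇒IIWins : IIWins 𝕏 𝕐
    finite⇒IIWins = strategy , λ π follows →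
      -- Stages are natural numbers ordered by `≥`, later positions being the stronger ones.
      limitIsPartialCondensation {_≼_ = _≥_} ℕ.≤-refl (λ m≥n n≥k → ℕ.≤-trans n≥k m≥n)
        {R = Graph ∘ position π} (λ m≥n → position-mono π (ℕ.≤⇒≤′ m≥n))
        (sound ∘ position-good π follows) 0
        -- The pair of round `n` is on the list from stage `1+ n` on; the maximum also reaches the
        -- given stage `m`.
        λ { (n , refl) {m} _ → m ⊔ℕ 1+ n , ℕ.m≤m⊔n m (1+ n) ,
              position-mono π (ℕ.≤⇒≤′ (ℕ.m≤n⊔m m (1+ n)))
                (subst (pair (π n) ∈_) (sym (position-suc π n)) (here refl)) }

-- Formulas

-- Equations need functionality and inequations injectivity. For a universal quantifier `back` pulls
-- `y` back to some `x`; for an existential one `forth` carries the witness over. The good list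
-- grows with each quantifier.
finite⇒preserved : (S : FiniteSystem 𝕏 𝕐) → ∀ {l} → FiniteSystem.Good S l →
  ∀ {n xs ys} → (∀ k → (lookup xs k , lookup ys k) ∈ l) →
  ∀ {φ : Formula _ n} → Closure 𝒫₀ φ → Sat 𝕏 xs φ → Sat 𝕐 ys φ
finite⇒preserved S g xys∈l (base (eq u v)) xu≡xv =
  functional (sound g) (xys∈l u) (subst (λ x → (x , _) ∈ _) (sym xu≡xv) (xys∈l v))
  where open FiniteSystem S
finite⇒preserved S g xys∈l (base (neq u v)) xu≢xv yu≡yv =
  xu≢xv (injective (sound g) (xys∈l u) (subst (λ y → (_ , y) ∈ _) (sym yu≡yv) (xys∈l v)))
  where open FiniteSystem S
finite⇒preserved S g xys∈l (base (rel i v)) =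
  preserves (sound g) i (Pointwise.map⁺ (λ { {k} refl → xys∈l k }) (Pointwise.refl {_∼_ = _≡_} refl))
  where open FiniteSystem S
finite⇒preserved S g xys∈l (⋀ φs) sat j = finite⇒preserved S g xys∈l (φs j) (sat j)
finite⇒preserved S g xys∈l (⋁ φs) (j , sat) = j , finite⇒preserved S g xys∈l (φs j) sat
finite⇒preserved S g xys∈l (all φ) sat y =
  let x , g′ = back g y
  in finite⇒preserved S g′ (λ { 0F → here refl ; (1F+ k) → there (xys∈l k) }) φ (sat x)
  where open FiniteSystem S
finite⇒preserved S g xys∈l (some φ) (x , sat) =
  let y , g′ = forth g x
  in y , finite⇒preserved S g′ (λ { 0F → here refl ; (1F+ k) → there (xys∈l k) }) φ sat
  where open FiniteSystem S

module _ (em : ExcludedMiddle (suc ℓ)) {L : Language ℓ} {𝕏 𝕐 : Structure L} where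
  open Resizing em

  private
    emℓ : ExcludedMiddle ℓ
    emℓ = lowerExcludedMiddle em

  module _ (l : List (∣ 𝕏 ∣ × ∣ 𝕐 ∣)) where

    -- The head of the list is variable zero, so consing a pair is exactly the binding of a new
    -- variable on both sides.
    lefts : Vec ∣ 𝕏 ∣ (length l)
    lefts = Vec.map proj₁ (Vec.fromList l)

    rights : Vec ∣ 𝕐 ∣ (length l)
    rights = Vec.map proj₂ (Vec.fromList l)

    TypePreserved : Set (suc ℓ)
    TypePreserved = ∀ φ → Closure 𝒫₀ φ → Sat 𝕏 lefts φ → Sat 𝕐 rights φ

    Separated : Set (suc ℓ)
    Separated = ∃ λ φ → Closure 𝒫₀ φ × Sat 𝕏 lefts φ × ¬ Sat 𝕐 rights φ

    -- Excluded middle returns the separating formula itself and so acts as a choice function: one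
    -- formula per candidate answer, to be collected into a conjunction or disjunction.
    separated : ¬ TypePreserved → Separated
    separated ¬preserved = decidable-stable em λ ∄φ →
      ¬preserved λ φ φ∈𝒫 sat → decidable-stable emℓ λ ¬sat → ∄φ (φ , φ∈𝒫 , sat , ¬sat)

    variableOf : ∀ {x y} → (x , y) ∈ l →
                 ∃ λ u → lookup lefts u ≡ x × lookup rights u ≡ y
    variableOf xy∈l = u , lookup-u proj₁ , lookup-u proj₂
      where
      xy∈v = Vecₚ.∈-fromList⁺ xy∈l
      u    = VecAny.index xy∈v

      lookup-u : ∀ {C : Set ℓ} (f : ∣ 𝕏 ∣ × ∣ 𝕐 ∣ → C) →
                 lookup (Vec.map f (Vec.fromList l)) u ≡ f _
      lookup-u f = trans (lookup-map u f (Vec.fromList l)) (cong f (sym (VecAnyₚ.lookup-index xy∈v)))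

    variablesOf : ∀ {n} {xs : Vec ∣ 𝕏 ∣ n} {ys : Vec ∣ 𝕐 ∣ n} → Pointwise (Graph l) xs ys →
                  ∃ λ us → Vec.map (lookup lefts) us ≡ xs × Vec.map (lookup rights) us ≡ ys
    variablesOf []            = [] , refl , refl
    variablesOf (xy∈l ∷ xys∈l) =
      let u  , x≡  , y≡  = variableOf xy∈l
          us , xs≡ , ys≡ = variablesOf xys∈l
      in u ∷ us , cong₂ _∷_ x≡ xs≡ , cong₂ _∷_ y≡ ys≡

    -- Each clause comes from one kind of formula in `𝒫₀`: equations give functionality, inequations
    -- give injectivity by contraposition, and relations give preservation.
    typePreserved⇒sound : TypePreserved → IsPartialCondensation 𝕏 𝕐 (Graph l)
    typePreserved⇒sound p = record
      { functional = λ xy∈l xy′∈l →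
          let u , xu , yu = variableOf xy∈l
              v , xv , yv = variableOf xy′∈l
          in trans (sym yu) (trans (p (u ≐ v) (base (eq u v)) (trans xu (sym xv))) yv)
      ; injective  = λ xy∈l x′y∈l →
          let u , xu , yu = variableOf xy∈l
              v , xv , yv = variableOf x′y∈l
          in decidable-stable emℓ λ x≢x′ →
            p (neg (u ≐ v)) (base (neq u v)) (λ xu≡xv → x≢x′ (trans (sym xu) (trans xu≡xv xv)))
              (trans yu (sym yv))
      ; preserves  = λ i xys∈l sat →
          let us , xs≡ , ys≡ = variablesOf xys∈l
          in subst (⟦ 𝕐 ⟧ i) ys≡
               (p (rel i us) (base (rel i us)) (subst (⟦ 𝕏 ⟧ i) (sym xs≡) sat))
      }

  -- If every answer y to x failed, witnessed by formulas φ y, then ∃v ⋀_y φ y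
  -- would be true at the left tuple and false at the right one.
  typePreserved-forth : ∀ {l} → TypePreserved l → ∀ x → ∃ λ y → TypePreserved ((x , y) ∷ l)
  typePreserved-forth {l} p x = decidable-stable em λ ∄y →
    let φ y   = separated ((x , y) ∷ l) (λ q → ∄y (y , q))
        y , s = p (some (⋀ (λ y → proj₁ (φ y)))) (some (⋀ (λ y → proj₁ (proj₂ (φ y)))))
                  (x , λ y → proj₁ (proj₂ (proj₂ (φ y))))
    in proj₂ (proj₂ (proj₂ (φ y))) (s y)

  -- Dually, with ∀v ⋁_x φ x: at the left tuple every value x of v satisfies its own disjunct, while
  -- at the right one v = y satisfies none.
  typePreserved-back : ∀ {l} → TypePreserved l → ∀ y → ∃ λ x → TypePreserved ((x , y) ∷ l)
  typePreserved-back {l} p y = decidable-stable em λ ∄x →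
    let φ x   = separated ((x , y) ∷ l) (λ q → ∄x (x , q))
        x , s = p (all (⋁ (λ x → proj₁ (φ x)))) (all (⋁ (λ x → proj₁ (proj₂ (φ x)))))
                  (λ x → x , proj₁ (proj₂ (proj₂ (φ x)))) y
    in proj₂ (proj₂ (proj₂ (φ x))) s

  preserved⇒finite : 𝕏 ⋘[ 𝒫∞ω ] 𝕐 → FiniteSystem 𝕏 𝕐
  preserved⇒finite p = record
    { Good     = λ l → Resized (TypePreserved l)
    ; sound    = λ {l} g → typePreserved⇒sound l (unresize g)
    -- For the empty list both tuples are empty and the formulas concerned are sentences.
    ; nonempty = resize p
    ; forth    = λ g x → map₂ resize (typePreserved-forth (unresize g) x)
    ; back     = λ g y → map₂ resize (typePreserved-back (unresize g) y)
    }

-- Duality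

module _ {L : Language ℓ} where

  -- The two classes are not closed under `neg`, so a negation is represented by an equivalent
  -- formula of the other class. One formula must serve all structures, as its truth is carried from
  -- one to another.
  Complementary : ∀ {n} → Formula L n → Formula L n → Set (suc ℓ)
  Complementary φ ψ = ∀ 𝕏 ρ → Sat 𝕏 ρ ψ ⇔ (¬ Sat 𝕏 ρ φ)

  HasDuals : (𝓕 𝓖 : ∀ {n} → Pred (Formula L n) a) → Set (suc ℓ ⊔ a)
  HasDuals 𝓕 𝓖 = ∀ {n} {φ : Formula L n} → 𝓕 φ → ∃ λ ψ → 𝓖 ψ × Complementary φ ψ

  module _ (em : ExcludedMiddle ℓ) where

    private
      by-contradiction : {P : Set ℓ} → ¬ ¬ P → P
      by-contradiction = decidable-stable em

    𝒫₀-duals : HasDuals 𝒫₀ 𝒩₀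
    𝒫₀-duals (eq u v)  = neg (u ≐ v) , neq u v , λ _ _ → mk⇔ id id
    𝒫₀-duals (rel i v) = neg (rel i v) , nrel i v , λ _ _ → mk⇔ id id
    𝒫₀-duals (neq u v) = u ≐ v , eq u v , λ _ _ → mk⇔ contradiction by-contradiction

    𝒩₀-duals : HasDuals 𝒩₀ 𝒫₀
    𝒩₀-duals (eq u v)   = neg (u ≐ v) , neq u v , λ _ _ → mk⇔ id id
    𝒩₀-duals (nrel i v) = rel i v , rel i v , λ _ _ → mk⇔ contradiction by-contradiction
    𝒩₀-duals (neq u v)  = u ≐ v , eq u v , λ _ _ → mk⇔ contradiction by-contradiction

    module _ {𝓑 𝓒 : ∀ {n} → Pred (Formula L n) ℓ} (duals : HasDuals 𝓑 𝓒) where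

      -- De Morgan's laws. In the inductive clauses, contradiction is used where a witness has to be
      -- found, for the duals of `⋀` and `all`.
      closure-duals : HasDuals (Closure 𝓑) (Closure 𝓒)
      closure-duals (base φ) = let ψ , ψ∈𝓒 , φψ = duals φ in ψ , base ψ∈𝓒 , φψ
      closure-duals (⋀ φs) =
        ⋁ (λ j → proj₁ (closure-duals (φs j))) ,
        ⋁ (λ j → proj₁ (proj₂ (closure-duals (φs j)))) ,
        λ 𝕏 ρ → let compl j = proj₂ (proj₂ (closure-duals (φs j))) 𝕏 ρ in mk⇔
          (λ (j , s) t → to (compl j) s (t j))
          (λ ¬t → by-contradiction λ ∄s →
            ¬t λ j → by-contradiction λ ¬tj → ∄s (j , from (compl j) ¬tj))
        where open Equivalence
      closure-duals (⋁ φs) =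
        ⋀ (λ j → proj₁ (closure-duals (φs j))) ,
        ⋀ (λ j → proj₁ (proj₂ (closure-duals (φs j)))) ,
        λ 𝕏 ρ → let compl j = proj₂ (proj₂ (closure-duals (φs j))) 𝕏 ρ in mk⇔
          (λ s (j , t) → to (compl j) (s j) t)
          (λ ¬t j → from (compl j) λ t → ¬t (j , t))
        where open Equivalence
      closure-duals (all φ) =
        let ψ , ψ∈ , φψ = closure-duals φ
        in some ψ , some ψ∈ , λ 𝕏 ρ → mk⇔
          (λ (x , s) t → to (φψ 𝕏 (x ∷ ρ)) s (t x))
          (λ ¬t → by-contradiction λ ∄s →
            ¬t λ x → by-contradiction λ ¬tx → ∄s (x , from (φψ 𝕏 (x ∷ ρ)) ¬tx))
        where open Equivalence
      closure-duals (some φ) =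
        let ψ , ψ∈ , φψ = closure-duals φ
        in all ψ , all ψ∈ , λ 𝕏 ρ → mk⇔
          (λ s (x , t) → to (φψ 𝕏 (x ∷ ρ)) (s x) t)
          (λ ¬t x → from (φψ 𝕏 (x ∷ ρ)) λ t → ¬t (x , t))
        where open Equivalence

      -- Contraposition: if `φ` failed in `𝕏`, its dual would hold there, hence in `𝕐`, against
      -- `𝕐 ⊨ φ`. This is why the direction turns around.
      dualPreserved : {𝕏 𝕐 : Structure L} → 𝕏 ⋘[ Closure 𝓒 ] 𝕐 → 𝕐 ⋘[ Closure 𝓑 ] 𝕏
      dualPreserved {𝕏} {𝕐} p φ φ∈ 𝕐⊨φ =
        let ψ , ψ∈ , φψ = closure-duals φ∈
        in by-contradiction λ 𝕏⊭φ →
          to (φψ 𝕐 []) (p ψ ψ∈ (from (φψ 𝕏 []) 𝕏⊭φ)) 𝕐⊨φ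
        where open Equivalence

  module _ {𝓕 : Pred (Sentence L) (suc ℓ)} {𝕏 𝕐 : Structure L} where

    equivalent⁺ : 𝕏 ⋘[ 𝓕 ] 𝕐 → 𝕐 ⋘[ 𝓕 ] 𝕏 → 𝕏 ≡[ 𝓕 ] 𝕐
    equivalent⁺ p q φ φ∈𝓕 = mk⇔ (p φ φ∈𝓕) (q φ φ∈𝓕)

    equivalent⁻ : 𝕏 ≡[ 𝓕 ] 𝕐 → 𝕏 ⋘[ 𝓕 ] 𝕐 × 𝕐 ⋘[ 𝓕 ] 𝕏
    equivalent⁻ e = (λ φ φ∈𝓕 → Equivalence.to (e φ φ∈𝓕)) ,
                    (λ φ φ∈𝓕 → Equivalence.from (e φ φ∈𝓕))

  module _ {𝓕 𝓖 : Pred (Sentence L) (suc ℓ)} {𝕏 𝕐 : Structure L} where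

    preserved-∪⁺ : 𝕏 ⋘[ 𝓕 ] 𝕐 → 𝕏 ⋘[ 𝓖 ] 𝕐 → 𝕏 ⋘[ 𝓕 ∪ 𝓖 ] 𝕐
    preserved-∪⁺ p q φ (inj₁ φ∈𝓕) = p φ φ∈𝓕
    preserved-∪⁺ p q φ (inj₂ φ∈𝓖) = q φ φ∈𝓖

    preserved-∪⁻ : 𝕏 ⋘[ 𝓕 ∪ 𝓖 ] 𝕐 → 𝕏 ⋘[ 𝓕 ] 𝕐 × 𝕏 ⋘[ 𝓖 ] 𝕐
    preserved-∪⁻ p = (λ φ → p φ ∘ inj₁) , (λ φ → p φ ∘ inj₂)

-- The implications between the conditions

module _ {L : Language ℓ} {𝕏 𝕐 : Structure L} where

  extension⇒backAndForth : InSomeExtension (λ ℙ → Forcing._≼̇c_ ℙ 𝕏 𝕐) → HasBackAndForthSystem 𝕏 𝕐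
  extension⇒backAndForth (ℙ , p , p⊩) = forces⇒system ℙ p⊩

  -- Through the generic extension: the good lists are the conditions, and the system consists of
  -- parts of the relations that they force.
  finite⇒backAndForth : FiniteSystem 𝕏 𝕐 → HasBackAndForthSystem 𝕏 𝕐
  finite⇒backAndForth = extension⇒backAndForth ∘ system⇒extension

  finite⇒𝒫-preserved : FiniteSystem 𝕏 𝕐 → 𝕏 ⋘[ 𝒫∞ω ] 𝕐
  finite⇒𝒫-preserved S φ = finite⇒preserved S (FiniteSystem.nonempty S) (λ ())

module _ (em : ExcludedMiddle (suc ℓ)) {L : Language ℓ} where

  private
    emℓ : ExcludedMiddle ℓ
    emℓ = lowerExcludedMiddle em

  module _ {𝕏 𝕐 : Structure L} where

    IIWins⇒finite : Infinite ∣ 𝕏 ∣ → IIWins 𝕏 𝕐 → FiniteSystem 𝕏 𝕐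
    IIWins⇒finite infinite (σ , winning) =
      winning⇒finite σ (inj₁ (inhabited emℓ infinite)) winning

    𝒫⇒𝒩 : 𝕏 ⋘[ 𝒫∞ω ] 𝕐 → 𝕐 ⋘[ 𝒩∞ω ] 𝕏
    𝒫⇒𝒩 = dualPreserved emℓ (𝒩₀-duals emℓ)

    𝒩⇒𝒫 : 𝕐 ⋘[ 𝒩∞ω ] 𝕏 → 𝕏 ⋘[ 𝒫∞ω ] 𝕐
    𝒩⇒𝒫 = dualPreserved emℓ (𝒫₀-duals emℓ)

    finite⇒condensation : Infinite ∣ 𝕏 ∣ → Countable ∣ 𝕏 ∣ → Countable ∣ 𝕐 ∣ →
                          FiniteSystem 𝕏 𝕐 → 𝕏 ≼c 𝕐
    finite⇒condensation infinite countable𝕏 countable𝕐 S =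
      winning⇒condensation (proj₁ (finite⇒IIWins emℓ S))
        (enumeration emℓ (inj₁ (inhabited emℓ infinite))
          (interleave-injective _ _ (Injection.injective countable𝕏)
                                    (Injection.injective countable𝕐)))
        (proj₂ (finite⇒IIWins emℓ S))

    condensation⇒finite : 𝕏 ≼c 𝕐 → FiniteSystem 𝕏 𝕐
    condensation⇒finite = backAndForth⇒finite em ∘ condensation⇒backAndForth

theorem4p1 : {ℓ : Level} → ExcludedMiddle (suc ℓ) →
    (L : Language ℓ) (𝕏 𝕐 : Structure L) → Infinite ∣ 𝕏 ∣ → Infinite ∣ 𝕐 ∣ →
    ( (InSomeExtension (λ ℙ → Forcing._≼̇c_ ℙ 𝕏 𝕐) ⇔ HasBackAndForthSystem 𝕏 𝕐)
    × (HasBackAndForthSystem 𝕏 𝕐 ⇔ IIWins 𝕏 𝕐)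
    × (IIWins 𝕏 𝕐 ⇔ (𝕏 ⋘[ 𝒫∞ω ] 𝕐))
    × ((𝕏 ⋘[ 𝒫∞ω ] 𝕐) ⇔ (𝕐 ⋘[ 𝒩∞ω ] 𝕏))
    × (Countable ∣ 𝕏 ∣ → Countable ∣ 𝕐 ∣ → (𝕐 ⋘[ 𝒩∞ω ] 𝕏) ⇔ (𝕏 ≼c 𝕐))
    )
    ×
    ( (InSomeExtension (λ ℙ → Forcing._~̇c_ ℙ 𝕏 𝕐) ⇔ (HasBackAndForthSystem 𝕏 𝕐 × HasBackAndForthSystem 𝕐 𝕏))
    × ((HasBackAndForthSystem 𝕏 𝕐 × HasBackAndForthSystem 𝕐 𝕏) ⇔ (IIWins 𝕏 𝕐 × IIWins 𝕐 𝕏))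
    × ((IIWins 𝕏 𝕐 × IIWins 𝕐 𝕏) ⇔ (𝕏 ≡[ 𝒫∞ω ] 𝕐))
    × ((𝕏 ≡[ 𝒫∞ω ] 𝕐) ⇔ (𝕏 ≡[ 𝒩∞ω ] 𝕐))
    × ((𝕏 ≡[ 𝒩∞ω ] 𝕐) ⇔ (𝕏 ≡[ 𝒫∞ω ∪ 𝒩∞ω ] 𝕐))
    × ((𝕏 ≡[ 𝒫∞ω ∪ 𝒩∞ω ] 𝕐) ⇔ (𝕏 ⋘[ 𝒫∞ω ∪ 𝒩∞ω ] 𝕐))
    × (Countable ∣ 𝕏 ∣ → Countable ∣ 𝕐 ∣ → (𝕏 ⋘[ 𝒫∞ω ∪ 𝒩∞ω ] 𝕐) ⇔ (𝕏 ~c 𝕐))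
    )
theorem4p1 em L 𝕏 𝕐 inf𝕏 inf𝕐 =
  ( mk⇔ extension⇒backAndForth (system⇒extension ∘ fromBF)
  , mk⇔ (finite⇒IIWins emℓ ∘ fromBF) (finite⇒backAndForth ∘ fromGame)
  , mk⇔ (finite⇒𝒫-preserved ∘ fromGame) (finite⇒IIWins emℓ ∘ preserved⇒finite em)
  , mk⇔ (𝒫⇒𝒩 em) (𝒩⇒𝒫 em)
  , λ c𝕏 c𝕐 → mk⇔
      (finite⇒condensation em inf𝕏 c𝕏 c𝕐 ∘ preserved⇒finite em ∘ 𝒩⇒𝒫 em)
      (𝒫⇒𝒩 em ∘ finite⇒𝒫-preserved ∘ condensation⇒finite em)
  ) ,
  ( mk⇔ (λ (ℙ , p , p⊩ , p⊩′) → forces⇒system ℙ p⊩ , forces⇒system ℙ p⊩′)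
        (λ (b , b′) → systems⇒extension (fromBF b) (fromBF b′))
  , mk⇔ (λ (b , b′) → finite⇒IIWins emℓ (fromBF b) , finite⇒IIWins emℓ (fromBF b′))
        (λ (w , w′) → finite⇒backAndForth (fromGame w) , finite⇒backAndForth (fromGame′ w′))
  , mk⇔ (λ (w , w′) → equivalent⁺ (finite⇒𝒫-preserved (fromGame w))
                                   (finite⇒𝒫-preserved (fromGame′ w′)))
        (λ e → let p , p′ = equivalent⁻ e in
           finite⇒IIWins emℓ (preserved⇒finite em p) , finite⇒IIWins emℓ (preserved⇒finite em p′))
  -- Duality reverses the direction, so `p` and `p′` trade places.
  , mk⇔ (λ e → let p , p′ = equivalent⁻ e in equivalent⁺ (𝒫⇒𝒩 em p′) (𝒫⇒𝒩 em p))
        (λ e → let p , p′ = equivalent⁻ e in equivalent⁺ (𝒩⇒𝒫 em p′) (𝒩⇒𝒫 em p))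
  , mk⇔ (λ e → let p , p′ = equivalent⁻ e in
           equivalent⁺ (preserved-∪⁺ (𝒩⇒𝒫 em p′) p) (preserved-∪⁺ (𝒩⇒𝒫 em p) p′))
        (λ e φ φ∈𝒩 → e φ (inj₂ φ∈𝒩))
  , mk⇔ (proj₁ ∘ equivalent⁻)
        -- Duality turns each half into the reversed preservation of the other class, so one
        -- direction for the union yields both.
        (λ p → let p𝒫 , p𝒩 = preserved-∪⁻ p in
           equivalent⁺ p (preserved-∪⁺ (𝒩⇒𝒫 em p𝒩) (𝒫⇒𝒩 em p𝒫)))
  , λ c𝕏 c𝕐 → mk⇔
      (λ p → let p𝒫 , p𝒩 = preserved-∪⁻ p in
         finite⇒condensation em inf𝕏 c𝕏 c𝕐 (preserved⇒finite em p𝒫) ,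
         finite⇒condensation em inf𝕐 c𝕐 c𝕏 (preserved⇒finite em (𝒩⇒𝒫 em p𝒩)))
      (λ (c , c′) →
         preserved-∪⁺ (finite⇒𝒫-preserved (condensation⇒finite em c))
                      (𝒫⇒𝒩 em (finite⇒𝒫-preserved (condensation⇒finite em c′))))
  )
  where
  emℓ       = lowerExcludedMiddle em
  fromBF    = backAndForth⇒finite em
  fromGame  = IIWins⇒finite em inf𝕏
  fromGame′ = IIWins⇒finite em inf𝕐
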